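{- Let $P$ be a finite definite logic program and let $S \subseteq \mathcal{TB}$. Assume that there exists a level mapping $|\ | : S \to \mathbb{N}$ such that for each $A \in S$ there exist a clause $C \in P$ and atoms $A_1,\dots,A_n$ with $\{A_1,\dots,A_n\} \subseteq S$, $A \in \mathbf{T}^\pi_{\{C\}}(\{A_1,\dots,A_n\})$, and $|A| > |A_i|$ for $i=1,\dots,n$. Then $S \subseteq \mathcal{O}(P)$.
   Context: Definite clause logic programs over a fixed alphabet; $\mathcal{TB}$ denotes the set of all (not necessarily ground) atoms over the alphabet, $\mathbb{N}$ the natural numbers. The s-semantics of $P$ is the set $\mathcal{O}(P)$ of all atoms $A$ such that $A = p(V_1,\dots,V_n)\theta$, where $p$ is an $n$-ary predicate symbol, $V_1,\dots,V_n$ are distinct variables, and $\theta$ is an SLD-computed answer substitution for the query $p(V_1,\dots,V_n)$ in $P$. For a program $Q$, the operator $\mathbf{T}^\pi_Q : 2^{\mathcal{TB}} \to 2^{\mathcal{TB}}$ is defined by: $\mathbf{T}^\pi_Q(I)$ is the set of all atoms $H\theta$ such that there are a clause $(H \gets B_1,\dots,B_m) \in Q$ and atoms $A_1,\dots,A_m \in I$ with $A_1,\dots,A_m,(H\gets B_1,\dots,B_m)$ pairwise variable disjoint and $\theta$ an mgu of $(B_1,\dots,B_m)$ and $(A_1,\dots,A_m)$; $\mathbf{T}^\pi_{\{C\}}$ is this operator for the one-clause program $\{C\}$. A level mapping on $S$ is a function $|\ | : S \to \mathbb{N}$ such that whenever $A,A' \in S$ are variants of each other, $|A| = |A'|$.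 A program is complete w.r.t. $S$ when $S\subseteq\mathcal{O}(P)$. -}

module Defs where

open import Data.Nat using (ℕ; _<_)
open import Data.Fin using (Fin)
open import Data.Vec using (Vec; []; _∷_; tabulate)
open import Data.List using (List; []; _∷_; _++_; map; length)
open import Data.List.Membership.Propositional using (_∈_)
open import Data.List.Relation.Unary.All using (All)
open import Data.List.Relation.Unary.AllPairs using (AllPairs)
import Data.Vec.Relation.Unary.Any as VAny
import Data.List.Relation.Unary.Any as LAny
open import Data.Product using (Σ; ∃; _×_; _,_; proj₁; proj₂)
open import Data.Sum using (_⊎_)
open import Relation.Nullary using (¬_)
open import Relation.Binary.PropositionalEquality using (_≡_; _≢_)
open import Function.Definitions using (Injective)

record Alphabet : Set₁ where
  field
    FunSym   : Set
    funArity : FunSym → ℕ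
    PredSym  : Set
    predArity : PredSym → ℕ

module Logic (Σa : Alphabet) where
  open Alphabet Σa

  Var : Set
  Var = ℕ

  data Term : Set where
    var : Var → Term
    fn  : (f : FunSym) → Vec Term (funArity f) → Term

  data Atom : Set where
    atom : (p : PredSym) → Vec Term (predArity p) → Atom

  record Clause : Set where
    constructor _⇐_
    field
      head : Atom
      body : List Atom
  open Clause public

  Program : Set
  Program = List Clause

  -- substitutions (identity outside their domain)
  Subst : Set
  Subst = Var → Term

  idSubst : Subst
  idSubst = var

  mutual
    _·t_ : Term → Subst → Term
    var x ·t σ = σ x
    fn f ts ·t σ = fn f (ts ·ts σ)

    _·ts_ : ∀ {n} → Vec Term n → Subst → Vec Term n
    [] ·ts σ = []
    (t ∷ ts) ·ts σ = (t ·t σ) ∷ (ts ·ts σ)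

  _·a_ : Atom → Subst → Atom
  atom p ts ·a σ = atom p (ts ·ts σ)

  _·as_ : List Atom → Subst → List Atom
  As ·as σ = map (_·a σ) As

  _·c_ : Clause → Subst → Clause
  (H ⇐ B) ·c σ = (H ·a σ) ⇐ (B ·as σ)

  _∘s_ : Subst → Subst → Subst
  (θ ∘s σ) x = θ x ·t σ

  data OccursT (x : Var) : Term → Set where
    here   : OccursT x (var x)
    inside : ∀ {f ts} → VAny.Any (OccursT x) ts → OccursT x (fn f ts)

  OccursA : Var → Atom → Set
  OccursA x (atom p ts) = VAny.Any (OccursT x) ts

  OccursAs : Var → List Atom → Set
  OccursAs x As = LAny.Any (OccursA x) As

  OccursC : Var → Clause → Set
  OccursC x C = OccursA x (head C) ⊎ OccursAs x (body C)

  OccursS : Var → Subst → Set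
  OccursS y θ = ∃ λ x → (θ x ≢ var x) × (y ≡ x ⊎ OccursT y (θ x))

  UnifierAs : Subst → List Atom → List Atom → Set
  UnifierAs θ As Bs = (As ·as θ) ≡ (Bs ·as θ)

  MguAs : Subst → List Atom → List Atom → Set
  MguAs θ As Bs = UnifierAs θ As Bs ×
    (∀ σ → UnifierAs σ As Bs → ∃ λ η → ∀ x → σ x ≡ (θ x ·t η))

  Mgu : Subst → Atom → Atom → Set
  Mgu θ A B = MguAs θ (A ∷ []) (B ∷ [])

  renSubst : (Var → Var) → Subst
  renSubst ρ x = var (ρ x)

  VariantA : Atom → Atom → Set
  VariantA A A' = ∃ λ (ρ : Var → Var) → Injective _≡_ _≡_ ρ × (A' ≡ A ·a renSubst ρ)

  DisjointA : Atom → Atom → Set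
  DisjointA A B = ∀ x → OccursA x A → ¬ OccursA x B

  DisjointAC : Atom → Clause → Set
  DisjointAC A C = ∀ x → OccursA x A → ¬ OccursC x C

  InTπ : Clause → List Atom → Atom → Set
  InTπ C I A = ∃ λ (As : List Atom) → ∃ λ (θ : Subst) →
      All (_∈ I) As
    × AllPairs DisjointA As
    × All (λ B → DisjointAC B C) As
    × MguAs θ (body C) As
    × (A ≡ head C ·a θ)

  -- SLD derivations with standardization apart.  'Used' collects the variables
  -- of the initial query, of the clause variants used so far and of the mgus used so far.
  -- SLD P Used Q θ : there is a successful SLD-derivation of Q whose
  -- composed mgus are θ (computed answer = θ restricted to Var(Q₀)).
  data SLD (P : Program) : (Var → Set) → List Atom → Subst → Set₁ where
    done : ∀ {U} → SLD P U [] idSubst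
    step : ∀ {U} (L R : List Atom) (A : Atom) (C : Clause) (ρ : Var → Var) (θ σ : Subst)
      → C ∈ P
      → Injective _≡_ _≡_ ρ
      → (∀ x → OccursC x (C ·c renSubst ρ) → ¬ U x)
      → Mgu θ A (head (C ·c renSubst ρ))
      → SLD P (λ x → U x ⊎ OccursC x (C ·c renSubst ρ) ⊎ OccursS x θ)
              ((L ++ body (C ·c renSubst ρ) ++ R) ·as θ) σ
      → SLD P U (L ++ A ∷ R) (θ ∘s σ)

  ComputedAnswer : Program → List Atom → Subst → Set₁
  ComputedAnswer P Q θ = SLD P (λ x → OccursAs x Q) Q θ

  InO : Program → Atom → Set₁
  InO P A = ∃ λ (p : PredSym) → ∃ λ (V : Fin (predArity p) → Var) → ∃ λ θ →
      Injective _≡_ _≡_ V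
    × ComputedAnswer P (atom p (tabulate (λ i → var (V i))) ∷ []) θ
    × (A ≡ atom p (tabulate (λ i → var (V i))) ·a θ)

  IsLevelMapping : (S : Atom → Set) → ((A : Atom) → S A → ℕ) → Set
  IsLevelMapping S lvl = ∀ A A' (a : S A) (a' : S A') → VariantA A A' → lvl A a ≡ lvl A' a'

-- By induction on the level, every A in S has a proof tree for which it is principal: the tree
-- proves A, and every atom proved by the same tree is an instance of A. Conversely, a proof tree
-- of an instance of a query lifts to an SLD-derivation whose answer is still proved by that tree
-- and is at least as general as the instance. Starting from p(V₁,…,Vₙ), the answer and A are
-- therefore instances of each other, and renaming the last mgu makes them equal.
module Submission where

open import Defs
open import Data.Nat using (ℕ; zero; suc; _+_; _∸_; _⊔_; _≤_; _<_; z≤n; s≤s)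
open import Data.Nat.Properties
open import Data.Fin using (Fin; toℕ; zero; suc)
open import Data.Fin.Properties using (toℕ-injective)
open import Data.Vec using (Vec; []; _∷_; tabulate; lookup)
open import Data.Vec.Properties using (tabulate-cong; tabulate∘lookup; ∷-injectiveˡ; ∷-injectiveʳ)
import Data.Vec.Relation.Unary.Any as VAny
open import Data.List using (List; []; _∷_; _++_; map)
open import Data.List.Properties using (map-++)
import Data.List.Properties as List
open import Data.List.Membership.Propositional using (_∈_)
open import Data.List.Membership.Propositional.Properties using (∈-map⁻)
open import Data.List.Relation.Unary.All using (All; []; _∷_)
open import Data.List.Relation.Unary.AllPairs using (AllPairs; []; _∷_)
import Data.List.Relation.Unary.All as All
import Data.List.Relation.Unary.Any as LAny
import Data.List.Relation.Unary.Any.Properties as LAny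
open import Data.List.Relation.Binary.Pointwise using (Pointwise; []; _∷_; ++⁺)
open import Data.Product using (Σ; ∃; _×_; _,_; proj₁; proj₂)
open import Data.Sum using (_⊎_; inj₁; inj₂)
open import Data.Empty using (⊥-elim)
open import Function using (_∘_)
open import Relation.Nullary using (¬_; Dec; yes; no)
open import Relation.Binary.PropositionalEquality

module Resolution (Σa : Alphabet) where
  open Alphabet Σa
  open Logic Σa

  private
    variable
      σ τ θ : Subst
      m M N : ℕ

  -- Substitutions and occurrences of variables

  mutual
    ·t-cong : ∀ t → (∀ x → OccursT x t → σ x ≡ τ x) → t ·t σ ≡ t ·t τ
    ·t-cong (var x)   eq = eq x here
    ·t-cong (fn f ts) eq = cong (fn f) (·ts-cong ts (λ x → eq x ∘ inside))

    ·ts-cong : (ts : Vec Term m) → (∀ x → VAny.Any (OccursT x) ts → σ x ≡ τ x) →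
               ts ·ts σ ≡ ts ·ts τ
    ·ts-cong []       eq = refl
    ·ts-cong (t ∷ ts) eq =
      cong₂ _∷_ (·t-cong t (λ x → eq x ∘ VAny.here)) (·ts-cong ts (λ x → eq x ∘ VAny.there))

  ·a-cong : ∀ A → (∀ x → OccursA x A → σ x ≡ τ x) → A ·a σ ≡ A ·a τ
  ·a-cong (atom p ts) eq = cong (atom p) (·ts-cong ts eq)

  ·as-cong : ∀ As → (∀ x → OccursAs x As → σ x ≡ τ x) → As ·as σ ≡ As ·as τ
  ·as-cong []       eq = refl
  ·as-cong (A ∷ As) eq =
    cong₂ _∷_ (·a-cong A (λ x → eq x ∘ LAny.here)) (·as-cong As (λ x → eq x ∘ LAny.there))

  mutual
    ·t-∘ : ∀ t → t ·t (σ ∘s τ) ≡ (t ·t σ) ·t τ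
    ·t-∘ (var x)   = refl
    ·t-∘ (fn f ts) = cong (fn f) (·ts-∘ ts)

    ·ts-∘ : (ts : Vec Term m) → ts ·ts (σ ∘s τ) ≡ (ts ·ts σ) ·ts τ
    ·ts-∘ []       = refl
    ·ts-∘ (t ∷ ts) = cong₂ _∷_ (·t-∘ t) (·ts-∘ ts)

  ·a-∘ : ∀ A → A ·a (σ ∘s τ) ≡ (A ·a σ) ·a τ
  ·a-∘ (atom p ts) = cong (atom p) (·ts-∘ ts)

  ·as-∘ : ∀ As → As ·as (σ ∘s τ) ≡ (As ·as σ) ·as τ
  ·as-∘ []       = refl
  ·as-∘ (A ∷ As) = cong₂ _∷_ (·a-∘ A) (·as-∘ As)

  mutual
    ·t-id : ∀ t → t ·t idSubst ≡ t
    ·t-id (var x)   = refl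
    ·t-id (fn f ts) = cong (fn f) (·ts-id ts)

    ·ts-id : (ts : Vec Term m) → ts ·ts idSubst ≡ ts
    ·ts-id []       = refl
    ·ts-id (t ∷ ts) = cong₂ _∷_ (·t-id t) (·ts-id ts)

  mutual
    occursT? : ∀ x t → Dec (OccursT x t)
    occursT? x (var y) with x ≟ y
    ... | yes refl = yes here
    ... | no x≢y   = no λ { here → x≢y refl }
    occursT? x (fn f ts) with occursTs? x ts
    ... | yes o = yes (inside o)
    ... | no ¬o = no λ { (inside o) → ¬o o }

    occursTs? : ∀ x (ts : Vec Term m) → Dec (VAny.Any (OccursT x) ts)
    occursTs? x [] = no λ ()
    occursTs? x (t ∷ ts) with occursT? x t | occursTs? x ts
    ... | yes o | _      = yes (VAny.here o)
    ... | no _  | yes o  = yes (VAny.there o)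
    ... | no ¬o | no ¬os = no λ { (VAny.here o) → ¬o o ; (VAny.there o) → ¬os o }

  occursA? : ∀ x A → Dec (OccursA x A)
  occursA? x (atom p ts) = occursTs? x ts

  mutual
    occurs-·t : ∀ t {y} → OccursT y (t ·t σ) → ∃ λ x → OccursT x t × OccursT y (σ x)
    occurs-·t (var x)   o          = x , here , o
    occurs-·t (fn f ts) (inside o) with occurs-·ts ts o
    ... | x , ox , oy = x , inside ox , oy

    occurs-·ts : (ts : Vec Term m) → ∀ {y} → VAny.Any (OccursT y) (ts ·ts σ) →
                 ∃ λ x → VAny.Any (OccursT x) ts × OccursT y (σ x)
    occurs-·ts (t ∷ ts) (VAny.here o) with occurs-·t t o
    ... | x , ox , oy = x , VAny.here ox , oy
    occurs-·ts (t ∷ ts) (VAny.there o) with occurs-·ts ts o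
    ... | x , ox , oy = x , VAny.there ox , oy

  occurs-·as : ∀ As {y} → OccursAs y (As ·as σ) → ∃ λ x → OccursAs x As × OccursT y (σ x)
  occurs-·as (atom p ts ∷ As) (LAny.here o) with occurs-·ts ts o
  ... | x , ox , oy = x , LAny.here ox , oy
  occurs-·as (A ∷ As) (LAny.there o) with occurs-·as As o
  ... | x , ox , oy = x , LAny.there ox , oy

  mutual
    ·t-occurs : ∀ t {x y} → OccursT x t → OccursT y (σ x) → OccursT y (t ·t σ)
    ·t-occurs (var x)   here       oy = oy
    ·t-occurs (fn f ts) (inside o) oy = inside (·ts-occurs ts o oy)

    ·ts-occurs : (ts : Vec Term m) → ∀ {x y} → VAny.Any (OccursT x) ts → OccursT y (σ x) →
                 VAny.Any (OccursT y) (ts ·ts σ)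
    ·ts-occurs (t ∷ ts) (VAny.here o)  oy = VAny.here (·t-occurs t o oy)
    ·ts-occurs (t ∷ ts) (VAny.there o) oy = VAny.there (·ts-occurs ts o oy)

  -- Bounds on the variables of an expression

  mutual
    boundT : ∀ t → ∃ λ N → ∀ x → OccursT x t → x < N
    boundT (var x) = suc x , λ { _ here → ≤-refl }
    boundT (fn f ts) with boundTs ts
    ... | N , b = N , λ { x (inside o) → b x o }

    boundTs : (ts : Vec Term m) → ∃ λ N → ∀ x → VAny.Any (OccursT x) ts → x < N
    boundTs [] = 0 , λ _ ()
    boundTs (t ∷ ts) with boundT t | boundTs ts
    ... | N , b | N′ , b′ = N ⊔ N′ , λ
      { x (VAny.here o)  → m<n⇒m<n⊔o N′ (b x o)
      ; x (VAny.there o) → m<n⇒m<o⊔n N (b′ x o) }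

  boundA : ∀ A → ∃ λ N → ∀ x → OccursA x A → x < N
  boundA (atom p ts) = boundTs ts

  boundAs : ∀ As → ∃ λ N → ∀ x → OccursAs x As → x < N
  boundAs [] = 0 , λ _ ()
  boundAs (A ∷ As) with boundA A | boundAs As
  ... | N , b | N′ , b′ = N ⊔ N′ , λ
    { x (LAny.here o)  → m<n⇒m<n⊔o N′ (b x o)
    ; x (LAny.there o) → m<n⇒m<o⊔n N (b′ x o) }

  boundC : ∀ C → ∃ λ N → ∀ x → OccursC x C → x < N
  boundC (H ⇐ B) with boundA H | boundAs B
  ... | N , b | N′ , b′ = N ⊔ N′ , λ
    { x (inj₁ o) → m<n⇒m<n⊔o N′ (b x o)
    ; x (inj₂ o) → m<n⇒m<o⊔n N (b′ x o) }

  fn-head : ∀ {f g ss ts} → fn f ss ≡ fn g ts → f ≡ g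
  fn-head refl = refl

  fn-args : ∀ {f ss ts} → fn f ss ≡ fn f ts → ss ≡ ts
  fn-args refl = refl

  atom-pred : ∀ {p q ss ts} → atom p ss ≡ atom q ts → p ≡ q
  atom-pred refl = refl

  atom-args : ∀ {p ss ts} → atom p ss ≡ atom p ts → ss ≡ ts
  atom-args refl = refl

  mutual
    -- Serves to conclude from `A ≡ (A ·a η) ·a ζ` that `η` followed by `ζ` fixes every variable of
    -- `A`.
    ·t-cong⁻ : ∀ t → t ·t σ ≡ t ·t τ → ∀ x → OccursT x t → σ x ≡ τ x
    ·t-cong⁻ (var _)   eq x here       = eq
    ·t-cong⁻ (fn f ts) eq x (inside o) = ·ts-cong⁻ ts (fn-args eq) x o

    ·ts-cong⁻ : (ts : Vec Term m) → ts ·ts σ ≡ ts ·ts τ →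
                ∀ x → VAny.Any (OccursT x) ts → σ x ≡ τ x
    ·ts-cong⁻ (t ∷ ts) eq x (VAny.here o)  = ·t-cong⁻ t (∷-injectiveˡ eq) x o
    ·ts-cong⁻ (t ∷ ts) eq x (VAny.there o) = ·ts-cong⁻ ts (∷-injectiveʳ eq) x o

  -- Unification

  mutual
    size : Term → ℕ
    size (var x)   = 1
    size (fn f ts) = suc (sizes ts)

    sizes : Vec Term m → ℕ
    sizes []       = 0
    sizes (t ∷ ts) = size t + sizes ts

  size-positive : ∀ t → 1 ≤ size t
  size-positive (var x)   = ≤-refl
  size-positive (fn f ts) = s≤s z≤n

  mutual
    -- The value of `x` is a subterm of the value of any term containing `x`; the occurs check rests
    -- on this.
    size-occurs : ∀ {x t} σ → OccursT x t → size (σ x) ≤ size (t ·t σ)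
    size-occurs σ here       = ≤-refl
    size-occurs σ (inside o) = m≤n⇒m≤1+n (sizes-occurs σ o)

    sizes-occurs : ∀ {x} {ts : Vec Term m} σ → VAny.Any (OccursT x) ts →
                   size (σ x) ≤ sizes (ts ·ts σ)
    sizes-occurs σ (VAny.here o)  = m≤n⇒m≤n+o _ (size-occurs σ o)
    sizes-occurs σ (VAny.there o) = m≤n⇒m≤o+n _ (sizes-occurs σ o)

  Equations : Set
  Equations = List (Term × Term)

  Solves : Subst → Equations → Set
  Solves σ = All λ (s , t) → s ·t σ ≡ t ·t σ

  measure : Subst → Equations → ℕ
  measure σ []            = 0
  measure σ ((s , t) ∷ E) = size (s ·t σ) + measure σ E

  _·e_ : Equations → Subst → Equations
  E ·e σ = map (λ (s , t) → s ·t σ , t ·t σ) E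

  BoundedE : ℕ → Equations → Set
  BoundedE N = All λ (s , t) → (∀ x → OccursT x s → x < N) × (∀ x → OccursT x t → x < N)

  -- Bounds the moved variables as well as those of their images, which are the variables that
  -- `OccursS` counts. Variables from `N` on thus stay fresh.
  BoundedS : ℕ → Subst → Set
  BoundedS N θ = ∀ x → θ x ≡ var x ⊎ (x < N × (∀ y → OccursT y (θ x) → y < N))

  boundedS-∘t : ∀ t → BoundedS N θ → (∀ x → OccursT x t → x < N) →
                ∀ y → OccursT y (t ·t θ) → y < N
  boundedS-∘t t bθ bt y o with occurs-·t t o
  ... | x , ox , oy with bθ x
  ...   | inj₂ (_ , b) = b y oy
  ...   | inj₁ eq with subst (OccursT y) eq oy
  ...     | here = bt x ox

  zipE : Vec Term m → Vec Term m → Equations → Equations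
  zipE []       []       E = E
  zipE (s ∷ ss) (t ∷ ts) E = (s , t) ∷ zipE ss ts E

  solves-zipE⁺ : (ss ts : Vec Term m) → ∀ {E} → ss ·ts σ ≡ ts ·ts σ → Solves σ E →
                 Solves σ (zipE ss ts E)
  solves-zipE⁺ []       []       eq sol = sol
  solves-zipE⁺ (s ∷ ss) (t ∷ ts) eq sol =
    ∷-injectiveˡ eq ∷ solves-zipE⁺ ss ts (∷-injectiveʳ eq) sol

  solves-zipE⁻ : (ss ts : Vec Term m) → ∀ {E} → Solves σ (zipE ss ts E) →
                 ss ·ts σ ≡ ts ·ts σ × Solves σ E
  solves-zipE⁻ []       []       sol = refl , sol
  solves-zipE⁻ (s ∷ ss) (t ∷ ts) (eq ∷ sol) with solves-zipE⁻ ss ts sol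
  ... | eqs , sol′ = cong₂ _∷_ eq eqs , sol′

  measure-zipE : (ss ts : Vec Term m) → ∀ {E} →
                 measure σ (zipE ss ts E) ≡ sizes (ss ·ts σ) + measure σ E
  measure-zipE []       []       = refl
  measure-zipE {σ = σ} (s ∷ ss) (t ∷ ts) {E} =
    trans (cong (size (s ·t σ) +_) (measure-zipE ss ts)) (sym (+-assoc (size (s ·t σ)) _ _))

  boundedE-zipE : (ss ts : Vec Term m) → ∀ {E} →
                  (∀ x → VAny.Any (OccursT x) ss → x < N) →
                  (∀ x → VAny.Any (OccursT x) ts → x < N) →
                  BoundedE N E → BoundedE N (zipE ss ts E)
  boundedE-zipE []       []       bs bt b = b
  boundedE-zipE (s ∷ ss) (t ∷ ts) bs bt b =
    ((λ x → bs x ∘ VAny.here) , (λ x → bt x ∘ VAny.here)) ∷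
    boundedE-zipE ss ts (λ x → bs x ∘ VAny.there) (λ x → bt x ∘ VAny.there) b

  -- In `general`, a solution factors through `mgu` with itself as second factor, which makes `mgu`
  -- idempotent. The same solution can then be carried along after the mgu is applied to a goal.
  record Solved (N : ℕ) (E : Equations) : Set where
    constructor solved
    field
      mgu     : Subst
      solves  : Solves mgu E
      general : ∀ σ → Solves σ E → ∀ x → σ x ≡ mgu x ·t σ
      bounded : BoundedS N mgu

  _↦_ : Var → Term → Subst
  (x ↦ t) y with y ≟ x
  ... | yes _ = t
  ... | no  _ = var y

  ↦-self : ∀ x t → (x ↦ t) x ≡ t
  ↦-self x t with x ≟ x
  ... | yes _  = refl
  ... | no x≢x = ⊥-elim (x≢x refl)

  ↦-fresh : ∀ {x t} u → ¬ OccursT x u → u ·t (x ↦ t) ≡ u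
  ↦-fresh {x} {t} u ¬o = trans (·t-cong u eq) (·t-id u)
    where
    eq : ∀ y → OccursT y u → (x ↦ t) y ≡ var y
    eq y o with y ≟ x
    ... | yes refl = ⊥-elim (¬o o)
    ... | no _     = refl

  -- A solution already gives `x` and `t` the same value, so binding `x` to `t` beforehand changes
  -- nothing.
  ↦-absorb : ∀ {x t} → σ x ≡ t ·t σ → ∀ y → σ y ≡ (x ↦ t) y ·t σ
  ↦-absorb {x = x} eq y with y ≟ x
  ... | yes refl = eq
  ... | no _     = refl

  absorb : ∀ {δ} → (∀ y → σ y ≡ δ y ·t σ) → ∀ t → (t ·t δ) ·t σ ≡ t ·t σ
  absorb eq t = trans (sym (·t-∘ t)) (·t-cong t (λ y _ → sym (eq y)))

  solves-·e⁺ : ∀ {δ} E → (∀ y → σ y ≡ δ y ·t σ) → Solves σ E → Solves σ (E ·e δ)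
  solves-·e⁺ []            eq []          = []
  solves-·e⁺ ((s , t) ∷ E) eq (eq₁ ∷ sol) =
    trans (absorb eq s) (trans eq₁ (sym (absorb eq t))) ∷ solves-·e⁺ E eq sol

  solves-·e⁻ : ∀ {δ} E → Solves σ (E ·e δ) → Solves (δ ∘s σ) E
  solves-·e⁻ []            []          = []
  solves-·e⁻ ((s , t) ∷ E) (eq₁ ∷ sol) =
    trans (·t-∘ s) (trans eq₁ (sym (·t-∘ t))) ∷ solves-·e⁻ E sol

  measure-·e : ∀ {δ} E → (∀ y → σ y ≡ δ y ·t σ) → measure σ (E ·e δ) ≡ measure σ E
  measure-·e []            eq = refl
  measure-·e ((s , t) ∷ E) eq = cong₂ _+_ (cong size (absorb eq s)) (measure-·e E eq)

  boundedE-·e : ∀ {δ} E → BoundedS N δ → BoundedE N E → BoundedE N (E ·e δ)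
  boundedE-·e []            bδ []              = []
  boundedE-·e ((s , t) ∷ E) bδ ((bs , bt) ∷ b) =
    (boundedS-∘t s bδ bs , boundedS-∘t t bδ bt) ∷ boundedE-·e E bδ b

  boundedS-∘ : ∀ {δ} → BoundedS N δ → BoundedS N θ → BoundedS N (δ ∘s θ)
  boundedS-∘ {θ = θ} {δ} bδ bθ x with bδ x
  ... | inj₂ (x<N , b) = inj₂ (x<N , boundedS-∘t (δ x) bθ b)
  ... | inj₁ eq rewrite eq = bθ x

  boundedS-↦ : ∀ {x t} → x < N → (∀ y → OccursT y t → y < N) → BoundedS N (x ↦ t)
  boundedS-↦ {x = x} x<N bt y with y ≟ x
  ... | yes refl = inj₂ (x<N , bt)
  ... | no _     = inj₁ refl

  solved-swap : ∀ {s t E} → Solved N ((s , t) ∷ E) → Solved N ((t , s) ∷ E)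
  solved-swap (solved θ (eq ∷ sol) gen b) =
    solved θ (sym eq ∷ sol) (λ { σ (eq′ ∷ sol′) → gen σ (sym eq′ ∷ sol′) }) b

  -- Variable elimination. The binding leaves `t` alone because `x` does not occur in it, so it
  -- solves its own equation. Every solution of the whole list absorbs the binding and hence solves
  -- the substituted rest.
  solved-↦ : ∀ {x t E} → ¬ OccursT x t → x < N → (∀ y → OccursT y t → y < N) →
             Solved N (E ·e (x ↦ t)) → Solved N ((var x , t) ∷ E)
  solved-↦ {x = x} {t} {E} x∉t x<N bt (solved θ sol gen b) = solved ((x ↦ t) ∘s θ)
    (trans (cong (_·t θ) (trans (↦-self x t) (sym (↦-fresh t x∉t)))) (sym (·t-∘ t)) ∷ solves-·e⁻ E sol)
    (λ { σ (eq ∷ sol′) y →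
         let ab = ↦-absorb eq
         in trans (ab y) (sym (absorb (gen σ (solves-·e⁺ E ab sol′)) ((x ↦ t) y))) })
    (boundedS-∘ (boundedS-↦ x<N bt) b)

  -- The measure is the size of the left-hand sides under a fixed known solution σ: binding a
  -- variable does not change it, since σ is already a fixed point of the binding.
  unify : ∀ n E σ → measure σ E ≤ n → Solves σ E → BoundedE N E → Solved N E

  unify-var : ∀ n x t E σ → measure σ ((var x , t) ∷ E) ≤ suc n →
              σ x ≡ t ·t σ → Solves σ E → ¬ OccursT x t →
              x < N → (∀ y → OccursT y t → y < N) → BoundedE N E →
              Solved N ((var x , t) ∷ E)
  unify-var n x t E σ le eq sol x∉t x<N bt b = solved-↦ x∉t x<N bt
    (unify n (E ·e (x ↦ t)) σ
      -- The dropped left-hand side had size at least 1.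
      (subst (_≤ n) (sym (measure-·e E (↦-absorb eq)))
        (≤-pred (≤-trans (+-monoˡ-≤ _ (size-positive (σ x))) le)))
      (solves-·e⁺ E (↦-absorb eq) sol)
      (boundedE-·e E (boundedS-↦ x<N bt) b))

  unify n [] σ le [] [] = solved idSubst [] (λ _ _ _ → refl) (λ _ → inj₁ refl)
  unify zero ((s , t) ∷ E) σ le _ _
    with () ← ≤-trans (size-positive (s ·t σ)) (m+n≤o⇒m≤o _ le)
  unify (suc n) ((var x , var y) ∷ E) σ le (eq ∷ sol) ((bs , bt) ∷ b) with x ≟ y
  ... | yes refl
    with solved θ sol′ gen b′ ← unify n E σ
           (≤-pred (≤-trans (+-monoˡ-≤ _ (size-positive (σ x))) le)) sol b =
    solved θ (refl ∷ sol′) (λ { σ′ (_ ∷ s) → gen σ′ s }) b′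
  ... | no x≢y =
    unify-var n x (var y) E σ le eq sol (λ { here → x≢y refl }) (bs x here) bt b
  unify (suc n) ((var x , fn g ts) ∷ E) σ le (eq ∷ sol) ((bs , bt) ∷ b) =
    unify-var n x (fn g ts) E σ le eq sol
      -- If `x` occurred in `ts`, the value of `x` would be smaller than itself.
      (λ { (inside o) → <-irrefl (cong size eq) (s≤s (sizes-occurs σ o)) })
      (bs x here) bt b
  unify (suc n) ((fn f ss , var y) ∷ E) σ le (eq ∷ sol) ((bs , bt) ∷ b) = solved-swap
    -- Only left-hand sides are measured; the swap is harmless because `σ` equates the two sides.
    (unify-var n y (fn f ss) E σ (subst (λ u → size u + measure σ E ≤ suc n) eq le) (sym eq) sol
      (λ { (inside o) → <-irrefl (cong size (sym eq)) (s≤s (sizes-occurs σ o)) })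
      (bt y here) bs b)
  unify (suc n) ((fn f ss , fn g ts) ∷ E) σ le (eq ∷ sol) ((bs , bt) ∷ b)
    with refl ← fn-head eq
    with solved θ sol′ gen b′ ← unify n (zipE ss ts E) σ
           -- Removing the function symbol lowers the measure by exactly one.
           (subst (_≤ n) (sym (measure-zipE ss ts)) (≤-pred le))
           (solves-zipE⁺ ss ts (fn-args eq) sol)
           (boundedE-zipE ss ts (λ x → bs x ∘ inside) (λ x → bt x ∘ inside) b)
    with eqs′ , sol″ ← solves-zipE⁻ ss ts sol′ =
    solved θ (cong (fn f) eqs′ ∷ sol″)
      (λ { σ′ (eq′ ∷ s) → gen σ′ (solves-zipE⁺ ss ts (fn-args eq′) s) }) b′

  -- The known unifier `σ` ensures termination of the unification and factors through the mgu by
  -- itself.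
  unifyAtoms : ∀ A B σ → A ·a σ ≡ B ·a σ →
               (∀ x → OccursA x A → x < N) → (∀ x → OccursA x B → x < N) →
               ∃ λ θ → Mgu θ A B × (∀ x → σ x ≡ θ x ·t σ) × BoundedS N θ
  unifyAtoms (atom p ss) (atom q ts) σ eq bA bB with refl ← atom-pred eq
    with start ← solves-zipE⁺ ss ts (atom-args eq) []
    with solved θ sol gen b ← unify _ (zipE ss ts []) σ ≤-refl start (boundedE-zipE ss ts bA bB []) =
      θ
    , ( cong (λ us → atom p us ∷ []) (proj₁ (solves-zipE⁻ ss ts sol))
      , λ σ′ eq′ → σ′ , gen σ′ (solves-zipE⁺ ss ts (atom-args (List.∷-injectiveˡ eq′)) []) )
    , gen σ start
    , b

  -- Atoms that are instances of each other

  -- Outside the variables of A the extension shifts by a bound K of the variables of A ·a η; the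
  -- left inverse can then tell the two ranges apart.
  invertible-extension : ∀ A η ζ → A ≡ (A ·a η) ·a ζ →
    ∃ λ ρ → ∃ λ τ → (∀ x → ρ x ·t τ ≡ var x) × A ·a ρ ≡ A ·a η
  invertible-extension A@(atom p ts) η ζ A≡Aηζ = ext , inverse , inv , ·a-cong A onA
    where
    K : ℕ
    K = proj₁ (boundA (A ·a η))

    ext : Subst
    ext x with occursA? x A
    ... | yes _ = η x
    ... | no _  = var (x + K)

    inverse : Subst
    inverse y with y <? K
    ... | yes _ = ζ y
    ... | no _  = var (y ∸ K)

    onA : ∀ x → OccursA x A → ext x ≡ η x
    onA x o with occursA? x A
    ... | yes _ = refl
    ... | no ¬o = ⊥-elim (¬o o)

    inverse-old : ∀ y → y < K → inverse y ≡ ζ y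
    inverse-old y y<K with y <? K
    ... | yes _  = refl
    ... | no y≮K = ⊥-elim (y≮K y<K)

    inv : ∀ x → ext x ·t inverse ≡ var x
    inv x with occursA? x A
    -- The variables of `η x` lie below `K`, where `inverse` acts as `ζ`, and `ζ` undoes `η` on the
    -- variables of `A`.
    ... | yes o = trans
      (·t-cong (η x) (λ y oy → inverse-old y (proj₂ (boundA (A ·a η)) y (·ts-occurs ts o oy))))
      (sym (·ts-cong⁻ ts (trans (·ts-id ts) (trans (atom-args A≡Aηζ) (sym (·ts-∘ ts)))) x o))
    ... | no _ with x + K <? K
    ...   | yes lt = ⊥-elim (m+n≮n x K lt)
    ...   | no _   = cong var (m+n∸n≡m x K)

  -- Most general atoms

  argument : Vec Term m → Subst
  -- A default value: the variables of `mostGeneral` all lie below the arity.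
  argument []       x       = var x
  argument (t ∷ ts) zero    = t
  argument (t ∷ ts) (suc x) = argument ts x

  argument-toℕ : (ts : Vec Term m) (i : Fin m) → argument ts (toℕ i) ≡ lookup ts i
  argument-toℕ (t ∷ ts) zero    = refl
  argument-toℕ (t ∷ ts) (suc i) = argument-toℕ ts i

  tabulate-·ts : (V : Fin m → Var) → tabulate (λ i → var (V i)) ·ts σ ≡ tabulate (λ i → σ (V i))
  tabulate-·ts {zero}  V = refl
  tabulate-·ts {suc m} V = cong (_ ∷_) (tabulate-·ts (V ∘ suc))

  mostGeneral : PredSym → Atom
  mostGeneral p = atom p (tabulate (λ i → var (toℕ i)))

  mostGeneral-argument : ∀ p ts → mostGeneral p ·a argument ts ≡ atom p ts
  mostGeneral-argument p ts = cong (atom p) (trans (tabulate-·ts toℕ)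
    (trans (tabulate-cong (argument-toℕ ts)) (tabulate∘lookup ts)))

  -- Proof trees and their principal atoms

  data Tree : Set where
    node : Clause → List Tree → Tree

  -- Each node will cost one resolution step, so this is the fuel for `lift`.
  treeSize : List Tree → ℕ
  treeSize []                = 0
  treeSize (node C cs ∷ ts) = suc (treeSize cs + treeSize ts)

  treeSize-++ : ∀ ss ts → treeSize (ss ++ ts) ≡ treeSize ss + treeSize ts
  treeSize-++ []               ts = refl
  treeSize-++ (node C cs ∷ ss) ts = cong suc
    (trans (cong (treeSize cs +_) (treeSize-++ ss ts)) (sym (+-assoc (treeSize cs) _ _)))

  module _ (P : Program) where
    -- The tree stores clauses only, and the instances `τ` are chosen anew for each proved atom. One
    -- tree can thus prove many atoms, and a most general one among them makes sense.
    data Proves : Tree → Atom → Set where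
      node : ∀ {C cs A} → C ∈ P → ∀ τ → A ≡ head C ·a τ →
             Pointwise Proves cs (body C ·as τ) → Proves (node C cs) A

    mutual
      proves-·a : ∀ {t A} σ → Proves t A → Proves t (A ·a σ)
      proves-·a σ (node {C} C∈P τ refl ps) = node C∈P (τ ∘s σ) (sym (·a-∘ (head C)))
        (subst (Pointwise Proves _) (sym (·as-∘ (body C))) (proves-·as σ ps))

      proves-·as : ∀ {ts As} σ → Pointwise Proves ts As → Pointwise Proves ts (As ·as σ)
      proves-·as σ []       = []
      proves-·as σ (p ∷ ps) = proves-·a σ p ∷ proves-·as σ ps

    -- The first premise is only there to say that cs and Bs have the same length.
    provesAll-++⁻ : ∀ {cs ts Ds} Bs → Pointwise Proves cs (Bs ·as τ) →
                    Pointwise Proves (cs ++ ts) (Bs ·as σ ++ Ds) →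
                    Pointwise Proves cs (Bs ·as σ) × Pointwise Proves ts Ds
    provesAll-++⁻ []       []       qs = [] , qs
    provesAll-++⁻ (B ∷ Bs) (_ ∷ ps) (q ∷ qs) with provesAll-++⁻ Bs ps qs
    ... | qs₁ , qs₂ = q ∷ qs₁ , qs₂

    -- The analogue of a principal type: two principal atoms of one tree are instances of each
    -- other.
    Principal : Tree → Atom → Set
    Principal t A = Proves t A × (∀ A′ → Proves t A′ → ∃ λ η → A′ ≡ A ·a η)

    -- Since the As are variable disjoint, the instantiations of the single atoms can be merged.
    merge : ∀ {ts As Bs} (τ : Subst) → AllPairs DisjointA As → Pointwise Principal ts As →
            Pointwise Proves ts Bs →
            ∃ λ σ → (∀ x → ¬ OccursAs x As → σ x ≡ τ x) × As ·as σ ≡ Bs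
    merge τ [] [] [] = τ , (λ _ _ → refl) , refl
    merge {As = A ∷ As} {B ∷ Bs} τ (d ∷ ds) ((_ , gen) ∷ prs) (p ∷ ps)
      with μ′ , off , eqs ← merge τ ds prs ps | η , eq ← gen B p =
      μ , outside , cong₂ _∷_ (trans (·a-cong A onA) (sym eq)) (trans (·as-cong As (onAs d)) eqs)
      where
      μ : Subst
      μ x with occursA? x A
      ... | yes _ = η x
      ... | no _  = μ′ x

      onA : ∀ x → OccursA x A → μ x ≡ η x
      onA x o with occursA? x A
      ... | yes _ = refl
      ... | no ¬o = ⊥-elim (¬o o)

      offA : ∀ x → ¬ OccursA x A → μ x ≡ μ′ x
      offA x ¬o with occursA? x A
      ... | yes o = ⊥-elim (¬o o)
      ... | no _  = refl

      -- By disjointness the variables of the later atoms miss `A`, so `μ` falls through to `μ′`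
      -- there.
      onAs : ∀ {As} → All (DisjointA A) As → ∀ x → OccursAs x As → μ x ≡ μ′ x
      onAs (d ∷ ds) x (LAny.here o)  = offA x (λ o′ → d x o′ o)
      onAs (d ∷ ds) x (LAny.there o) = onAs ds x o

      -- This will let the variables of a clause disjoint from the atoms keep their values under
      -- `τ`.
      outside : ∀ x → ¬ OccursAs x (A ∷ As) → μ x ≡ τ x
      outside x ¬o = trans (offA x (¬o ∘ LAny.here)) (off x (¬o ∘ LAny.there))

    disjointC : ∀ {C As} → All (λ A → DisjointAC A C) As → ∀ x → OccursC x C → ¬ OccursAs x As
    disjointC (d ∷ ds) x oC (LAny.here o)  = d x o oC
    disjointC (d ∷ ds) x oC (LAny.there o) = disjointC ds x oC o

    -- Any other proof with this tree uses an instance `τ` of `C`, and its subtrees prove instances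
    -- of the `As`. Merging these instantiations with `τ` on `C` yields a unifier of the body and
    -- the `As`, which factors through the mgu `θ`.
    principal-node : ∀ {C ts As A} → C ∈ P → Pointwise Principal ts As →
                     AllPairs DisjointA As → All (λ B → DisjointAC B C) As →
                     MguAs θ (body C) As → A ≡ head C ·a θ → Principal (node C ts) A
    principal-node {θ} {C} {ts} {As} C∈P prs ds dC (eq , gen) refl =
      node C∈P θ refl (subst (Pointwise Proves ts) (sym eq) (proves-·as θ (proofs prs))) ,
      general
      where
      proofs : ∀ {ts As} → Pointwise Principal ts As → Pointwise Proves ts As
      proofs []               = []
      proofs ((p , _) ∷ prs) = p ∷ proofs prs

      general : ∀ A′ → Proves (node C ts) A′ → ∃ λ η → A′ ≡ (head C ·a θ) ·a η
      general _ (node _ τ refl ps)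
        with σ , off , eqs ← merge τ ds prs ps
        with η , ηeq ← gen σ (trans (·as-cong (body C) (λ x o → off x (disjointC dC x (inj₂ o))))
                                    (sym eqs)) =
        η , trans (·a-cong (head C) (λ x o → trans (sym (off x (disjointC dC x (inj₁ o)))) (ηeq x)))
                  (·a-∘ (head C))

    collect : ∀ {As} → All (λ A → ∃ λ t → Principal t A) As → ∃ λ ts → Pointwise Principal ts As
    collect []               = [] , []
    collect ((t , pr) ∷ prs) with collect prs
    ... | ts , prs′ = t ∷ ts , pr ∷ prs′

    -- Induction on a strict bound `n` of the level: the covering atoms have smaller levels, so
    -- their principal trees are available as subtrees.
    principal : (S : Atom → Set) (lvl : (A : Atom) → S A → ℕ) →
      (∀ A (a : S A) → ∃ λ (C : Clause) → ∃ λ (As : List (Σ Atom S)) →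
          C ∈ P
        × InTπ C (map proj₁ As) A
        × (∀ b → b ∈ As → lvl (proj₁ b) (proj₂ b) < lvl A a)) →
      ∀ n A (a : S A) → lvl A a < n → ∃ λ t → Principal t A
    principal S lvl cover (suc n) A a (s≤s lvl≤n)
      with C , Bs , C∈P , (As , θ , As⊆Bs , ds , dC , mgu , eq) , smaller ← cover A a
      with ts , prs ← collect (All.map
        -- `∈-map⁻` recovers the membership in `S` to which the level is attached.
        (λ { A∈ → let (B , b) , b∈Bs , eq′ = ∈-map⁻ proj₁ A∈
                      t , pr = principal S lvl cover n B b (≤-trans (smaller (B , b) b∈Bs) lvl≤n)
                  in t , subst (Principal t) (sym eq′) pr })
        As⊆Bs)
      = node C ts , principal-node C∈P prs ds dC mgu eq

    -- Lifting proof trees to SLD-derivations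

    -- The leftmost atom is resolved with the root clause of its tree, and the children of the root
    -- join the forest. All variables in use lie below `N`, so shifting the clause by `N`
    -- standardizes it apart, and `σ` is compared with the answer only below `N`. That the same
    -- trees prove the answer is what lets principality apply to it.
    lift : ∀ n {U} N ts Q σ → treeSize ts ≤ n → (∀ x → U x → x < N) →
           (∀ x → OccursAs x Q → x < N) → Pointwise Proves ts (Q ·as σ) →
           ∃ λ θ → SLD P U Q θ × Pointwise Proves ts (Q ·as θ) ×
           ∃ λ η → ∀ x → x < N → σ x ≡ θ x ·t η
    lift n N [] [] σ le bU bQ [] = idSubst , done , [] , σ , λ _ _ → refl
    lift (suc n) {U} N (node C cs ∷ ts) (A ∷ Q) σ (s≤s le) bU bQ (node C∈P τ eq ps ∷ qs) =
      θ₁ ∘s θ₂ ,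
      step [] Q A C ρ θ₁ θ₂ C∈P (+-cancelʳ-≡ N _ _) fresh mgu D ,
      (node C∈P (renSubst ρ ∘s (θ₁ ∘s θ₂)) headEq (proj₁ parts) ∷ proj₂ parts) ,
      -- On old variables `σ` is `σ′`, which absorbs `θ₁`; the variables of `θ₁ x` lie below `K`,
      -- where `σ′` is `θ₂` followed by `η`.
      η , λ x x<N → trans (sym (σ′-old x x<N))
            (trans (abs x)
            (trans (·t-cong (θ₁ x) (λ y o →
                     ans y (boundedS-∘t (var x) bθ (λ { _ here → ≤-trans x<N N≤K }) y o)))
                   (·t-∘ (θ₁ x))))
      where
      ρ : Var → Var
      ρ x = x + N

      Cρ : Clause
      Cρ = C ·c renSubst ρ

      -- The bound for the next step covers the old variables and those of the clause variant, hence
      -- also those of the mgu.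
      K : ℕ
      K = N ⊔ proj₁ (boundC Cρ)

      N≤K : N ≤ K
      N≤K = m≤m⊔n N _

      bC : ∀ x → OccursC x Cρ → x < K
      bC x o = m<n⇒m<o⊔n N (proj₂ (boundC Cρ) x o)

      -- Glues `σ` on the old variables to `τ` on the shifted clause variables, giving a common
      -- unifier of `A` and the renamed head.
      σ′ : Subst
      σ′ x with x <? N
      ... | yes _ = σ x
      ... | no _  = τ (x ∸ N)

      σ′-old : ∀ x → x < N → σ′ x ≡ σ x
      σ′-old x x<N with x <? N
      ... | yes _  = refl
      ... | no x≮N = ⊥-elim (x≮N x<N)

      σ′-new : ∀ x → σ′ (ρ x) ≡ τ x
      σ′-new x with x + N <? N
      ... | yes lt = ⊥-elim (m+n≮n x N lt)
      ... | no _   = cong τ (m+n∸n≡m x N)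

      fresh : ∀ x → OccursC x Cρ → ¬ U x
      fresh x o u with renamed o
        where
        renamed : OccursC x Cρ → ∃ λ y → x ≡ ρ y
        renamed (inj₁ o) with occurs-·as (head C ∷ []) (LAny.here o)
        ... | y , _ , here = y , refl
        renamed (inj₂ o) with occurs-·as (body C) o
        ... | y , _ , here = y , refl
      ... | y , refl = m+n≮n y N (bU (y + N) u)

      unified : A ·a σ′ ≡ head Cρ ·a σ′
      unified = trans (·a-cong A (λ x o → σ′-old x (bQ x (LAny.here o))))
        (trans eq (trans (·a-cong (head C) (λ x _ → sym (σ′-new x))) (·a-∘ (head C))))

      unifier : ∃ λ θ → Mgu θ A (head Cρ) × (∀ x → σ′ x ≡ θ x ·t σ′) × BoundedS K θ
      unifier = unifyAtoms A (head Cρ) σ′ unified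
        (λ x o → ≤-trans (bQ x (LAny.here o)) N≤K) (λ x o → bC x (inj₁ o))

      θ₁ = proj₁ unifier
      mgu = proj₁ (proj₂ unifier)
      abs = proj₁ (proj₂ (proj₂ unifier))
      bθ = proj₂ (proj₂ (proj₂ unifier))

      -- Since `σ′` absorbs `θ₁`, the resolvent under `σ′` consists of the atoms already proved by
      -- `cs` and `ts`.
      rest : Pointwise Proves (cs ++ ts) (((body Cρ ++ Q) ·as θ₁) ·as σ′)
      rest = subst (Pointwise Proves (cs ++ ts))
        (trans (cong₂ _++_
                 (trans (·as-cong (body C) (λ x _ → sym (σ′-new x))) (·as-∘ (body C)))
                 (·as-cong Q (λ x o → sym (σ′-old x (bQ x (LAny.there o))))))
        (trans (sym (map-++ (_·a σ′) (body Cρ) Q))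
        (trans (·as-cong (body Cρ ++ Q) (λ x _ → abs x)) (·as-∘ (body Cρ ++ Q)))))
        (++⁺ ps qs)

      bU′ : ∀ x → U x ⊎ OccursC x Cρ ⊎ OccursS x θ₁ → x < K
      bU′ x (inj₁ u)        = ≤-trans (bU x u) N≤K
      bU′ x (inj₂ (inj₁ o)) = bC x o
      bU′ x (inj₂ (inj₂ (y , θy≢y , o))) with bθ y | o
      ... | inj₁ eq        | _         = ⊥-elim (θy≢y eq)
      ... | inj₂ (y<K , b) | inj₁ refl = y<K
      ... | inj₂ (y<K , b) | inj₂ o    = b x o

      bQ′ : ∀ x → OccursAs x ((body Cρ ++ Q) ·as θ₁) → x < K
      bQ′ x o with occurs-·as (body Cρ ++ Q) o
      ... | y , oy , ox with LAny.++⁻ (body Cρ) oy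
      ...   | inj₁ ob = boundedS-∘t (var y) bθ (λ { _ here → bC y (inj₂ ob) }) x ox
      ...   | inj₂ oq = boundedS-∘t (var y) bθ (λ { _ here → ≤-trans (bQ y (LAny.there oq)) N≤K }) x ox

      IH = lift n K (cs ++ ts) ((body Cρ ++ Q) ·as θ₁) σ′
             (subst (_≤ n) (sym (treeSize-++ cs ts)) le) bU′ bQ′ rest

      θ₂ = proj₁ IH
      D = proj₁ (proj₂ IH)
      η = proj₁ (proj₂ (proj₂ (proj₂ IH)))
      ans = proj₂ (proj₂ (proj₂ (proj₂ IH)))

      -- The clause instance at the root is now the renaming followed by the whole answer.
      parts : Pointwise Proves cs (body C ·as (renSubst ρ ∘s (θ₁ ∘s θ₂))) ×
              Pointwise Proves ts (Q ·as (θ₁ ∘s θ₂))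
      parts = provesAll-++⁻ (body C) ps (subst (Pointwise Proves (cs ++ ts))
        (trans (sym (·as-∘ (body Cρ ++ Q)))
        (trans (map-++ (_·a (θ₁ ∘s θ₂)) (body Cρ) Q)
               (cong (_++ (Q ·as (θ₁ ∘s θ₂))) (sym (·as-∘ (body C))))))
        (proj₁ (proj₂ (proj₂ IH))))

      headEq : A ·a (θ₁ ∘s θ₂) ≡ head C ·a (renSubst ρ ∘s (θ₁ ∘s θ₂))
      headEq = trans (·a-∘ A) (trans (cong (_·a θ₂) (List.∷-injectiveˡ (proj₁ mgu)))
        (trans (sym (·a-∘ (head Cρ))) (sym (·a-∘ (head C)))))

    -- Renaming computed answers and the s-semantics

    -- Only the last mgu has to be changed: the resolvent after it is empty.
    sld-rename : ∀ {U Q ω ρ} → (∀ x → ρ x ·t τ ≡ var x) → SLD P U Q ω →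
                 (Q ≡ [] × ω ≡ idSubst) ⊎
                 (∃ λ ω′ → SLD P U Q ω′ × (∀ x → ω′ x ≡ ω x ·t ρ))
    sld-rename inv done = inj₁ (refl , refl)
    sld-rename {τ} {U} {ρ = ρ} inv (step L R A C κ θ σ C∈P inj fresh mgu D) with sld-rename inv D
    ... | inj₂ (ω′ , D′ , eq) = inj₂
      ( θ ∘s ω′ , step L R A C κ θ ω′ C∈P inj fresh mgu D′
      , λ x → trans (·t-cong (θ x) (λ y _ → eq y)) (·t-∘ (θ x)) )
    ... | inj₁ (empty , refl) = inj₂
      ( (θ ∘s ρ) ∘s idSubst , step L R A C κ (θ ∘s ρ) idSubst C∈P inj fresh mgu′ D′
      , λ x → trans (·t-id (θ x ·t ρ)) (cong (_·t ρ) (sym (·t-id (θ x)))) )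
      where
      H : Atom
      H = head (C ·c renSubst κ)

      resolvent : List Atom
      resolvent = L ++ body (C ·c renSubst κ) ++ R

      -- The changed mgu alters the set of used variables, but `done` accepts any such set.
      D′ : ∀ {U} → SLD P U (resolvent ·as (θ ∘s ρ)) idSubst
      D′ = subst (λ Q → SLD P _ Q idSubst)
             (sym (trans (·as-∘ resolvent) (cong (_·as ρ) empty))) done

      -- Generality survives because `τ` undoes `ρ`: the new factor is `τ` followed by the old one.
      mgu′ : Mgu (θ ∘s ρ) A H
      mgu′ =
        trans (·as-∘ (A ∷ [])) (trans (cong (_·as ρ) (proj₁ mgu)) (sym (·as-∘ (H ∷ [])))) ,
        λ σ unif → let η , eq = proj₂ mgu σ unif in
          τ ∘s η , λ x → trans (eq x) (trans
            (cong (_·t η) (trans (sym (·t-id (θ x)))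
              (trans (·t-cong (θ x) (λ y _ → sym (inv y))) (·t-∘ (θ x)))))
            (sym (·t-∘ (θ x ·t ρ))))

    principal⇒InO : ∀ {t} A → Principal t A → InO P A
    principal⇒InO {t} (atom p ts) (proof , general)
      with Q·args ← mostGeneral-argument p ts
      with N , bQ ← boundAs (mostGeneral p ∷ [])
      with ω , D , proof′ ∷ [] , η , ans ←
             lift _ N (t ∷ []) (mostGeneral p ∷ []) (argument ts) ≤-refl bQ bQ
               (subst (Proves t) (sym Q·args) proof ∷ [])
      -- Principality makes the answer an instance of `A`, while lifting made `A` an instance of the
      -- answer. Hence `η` can be replaced by an invertible `ρ` with the same effect on the answer
      -- atom.
      with ζ , Qω≡Aζ ← general (mostGeneral p ·a ω) proof′
      with A≡Qωη ← trans (sym Q·args)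
                     (trans (·a-cong (mostGeneral p) (λ x o → ans x (bQ x (LAny.here o))))
                            (·a-∘ (mostGeneral p)))
      with ρ , τ , inv , Qωρ≡Qωη ←
             invertible-extension (mostGeneral p ·a ω) η ζ (trans Qω≡Aζ (cong (_·a ζ) A≡Qωη))
      with sld-rename inv D
    -- The query is nonempty, so its derivation has a last mgu to rename.
    ... | inj₂ (ω′ , D′ , eq) =
      p , toℕ , ω′ , toℕ-injective , D′ ,
      sym (trans (·a-cong (mostGeneral p) (λ x _ → eq x))
          (trans (·a-∘ (mostGeneral p)) (trans Qωρ≡Qωη (sym A≡Qωη))))

open Resolution

theorem2 : (Σa : Alphabet) → let open Logic Σa in
    (P : Program) (S : Atom → Set) (lvl : (A : Atom) → S A → ℕ) →
    IsLevelMapping S lvl →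
    (∀ A (a : S A) → ∃ λ (C : Clause) → ∃ λ (As : List (Σ Atom S)) →
    C ∈ P
    × InTπ C (map proj₁ As) A
    × (∀ b → b ∈ As → lvl (proj₁ b) (proj₂ b) < lvl A a)) →
    ∀ A → S A → InO P A
theorem2 Σa P S lvl _ cover A a =
  principal⇒InO Σa P A (proj₂ (principal Σa P S lvl cover _ A a ≤-refl))
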